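{- Let $n\geq 0$ be an integer and $x$ a complex number (with $x^2\neq 1$ in the second identity). Then $$\sum_{k=0}^{n-1}\binom{n}{k}\bigl(\sqrt{x^2+4}\bigr)^{n-1-k}\bigl(1-(-1)^{n-k}\bigr)T_k(x)= \sum_{k=1}^{n}\binom{n}{k}2^{k-1}\bigl(\sqrt{x^2-1}\bigr)^{n-k}\bigl(1+(-1)^{n-k}\bigr)F_k(x)$$ and $$\sum_{k=0}^{n-1}\binom{n}{k}\bigl(\sqrt{x^2+4}\bigr)^{n-1-k}\bigl(1-(-1)^{n-k}\bigr)U_k(x)= \sum_{k=1}^{n}\binom{n}{k}2^{k-1}\bigl(\sqrt{x^2-1}\bigr)^{n-1-k}\bigl(\alpha(x)-(-1)^{n-k}\beta(x)\bigr)F_k(x).$$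
   Context: The Chebyshev polynomials of the first kind $T_n(x)$ and of the second kind $U_n(x)$ are defined by $T_0(x)=1$, $T_1(x)=x$, $T_{n+1}(x)=2xT_n(x)-T_{n-1}(x)$, and $U_0(x)=1$, $U_1(x)=2x$, $U_{n+1}(x)=2xU_n(x)-U_{n-1}(x)$ for $n\ge 1$. The (Catalan) Fibonacci polynomials $F_n(x)$ are defined by $F_0(x)=0$, $F_1(x)=1$, $F_n(x)=xF_{n-1}(x)+F_{n-2}(x)$ for $n\geq 2$. Put $\alpha(x)=x+\sqrt{x^2-1}$ and $\beta(x)=x-\sqrt{x^2-1}$. Here $\sqrt{x^2-1}$ and $\sqrt{x^2+4}$ denote fixed complex square roots, the same choice being used throughout. Conventions: $0^0=1$, and a sum whose upper limit is smaller than its lower limit is $0$. -}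

module Defs where

open import Level using (0ℓ)
open import Algebra.Apartness.Bundles using (HeytingField; HeytingCommutativeRing)
open import Algebra.Bundles using (CommutativeRing)
open import Data.Nat.Base as ℕ using (ℕ; zero; suc)
open import Data.Integer.Base as ℤ using (ℤ)

private module RationalArithmetic where

  open import Data.Rational.Base
  open import Data.Rational.Properties
  open import Data.Rational.Solver using (module +-*-Solver)
  open import Data.Product.Base using (∃-syntax; _×_; _,_)
  open import Data.Sum.Base using (_⊎_; inj₁; inj₂)
  open import Data.Empty using (⊥-elim)
  open import Relation.Nullary using (yes; no)
  open import Relation.Binary.PropositionalEquality
  open +-*-Solver

  half : ℚ → ℚ
  half p = ½ * p

  dist : ℚ → ℚ → ℚ
  dist p q = ∣ p - q ∣

  abstract

    <-+ˡ : ∀ p q r → p < q → 0ℚ < r → p < q + r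
    <-+ˡ p q r p<q 0<r = subst (_< q + r) (+-identityʳ p) (+-mono-< p<q 0<r)

    <-+ʳ : ∀ p q r → p < r → 0ℚ < q → p < q + r
    <-+ʳ p q r p<r 0<q = subst (_< q + r) (+-identityˡ p) (+-mono-< 0<q p<r)

    half+half : ∀ p → half p + half p ≡ p
    half+half = solve 1 (λ p → con ½ :* p :+ con ½ :* p := p) refl

    *-pos : ∀ {p q} → 0ℚ < p → 0ℚ < q → 0ℚ < p * q
    *-pos {p} {q} 0<p 0<q =
      subst (_< p * q) (*-zeroʳ p) (*-monoʳ-<-pos p {{positive 0<p}} 0<q)

    half-pos : ∀ {p} → 0ℚ < p → 0ℚ < half p
    half-pos = *-pos (positive⁻¹ ½)

    1/-pos : ∀ {p} → 0ℚ < p → ∃[ q ] 0ℚ < q × p * q ≡ 1ℚ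
    1/-pos {p} 0<p =
      (1/ p) {{nz}} , positive⁻¹ _ {{1/pos⇒pos p {{p>0}}}} , *-inverseʳ p {{nz}}
      where
      p>0 : Positive p
      p>0 = positive 0<p
      nz : NonZero p
      nz  = pos⇒nonZero p {{p>0}}

    dist-self : ∀ p → dist p p ≡ 0ℚ
    dist-self p = cong ∣_∣ (+-inverseʳ p)

    dist-sym : ∀ p q → dist p q ≡ dist q p
    dist-sym p q =
      trans (cong ∣_∣ (solve 2 (λ p q → p :- q := :- (q :- p)) refl p q)) (∣-p∣≡∣p∣ (q - p))

    dist-tri : ∀ p q r → dist p r ≤ dist p q + dist q r
    dist-tri p q r =
      ≤-trans (≤-reflexive (cong ∣_∣ (solve 3 (λ p q r → p :- r := (p :- q) :+ (q :- r)) refl p q r)))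
              (∣p+q∣≤∣p∣+∣q∣ (p - q) (q - r))

    dist-0 : ∀ p → dist p 0ℚ ≡ ∣ p ∣
    dist-0 p = cong ∣_∣ (solve 1 (λ p → p :- con 0ℚ := p) refl p)

    dist-neg : ∀ p q → dist (- p) (- q) ≡ dist p q
    dist-neg p q =
      trans (cong ∣_∣ (solve 2 (λ p q → (:- p) :- (:- q) := :- (p :- q)) refl p q)) (∣-p∣≡∣p∣ (p - q))

    dist-minus : ∀ p q → dist (p - q) 0ℚ ≡ dist p q
    dist-minus p q = dist-0 (p - q)

    dist-trans-< : ∀ {ε} p q r → dist p q < half ε → dist q r < half ε → dist p r < ε
    dist-trans-< {ε} p q r h k =
      ≤-<-trans (dist-tri p q r) (<-≤-trans (+-mono-< h k) (≤-reflexive (half+half ε)))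

    dist-+-< : ∀ {ε} p p′ q q′ → dist p p′ < half ε → dist q q′ < half ε →
               dist (p + q) (p′ + q′) < ε
    dist-+-< {ε} p p′ q q′ h k =
      ≤-<-trans
        (≤-trans
          (≤-reflexive (cong ∣_∣ (solve 4 (λ p p′ q q′ → (p :+ q) :- (p′ :+ q′) := (p :- p′) :+ (q :- q′))
                                          refl p p′ q q′)))
          (∣p+q∣≤∣p∣+∣q∣ (p - p′) (q - q′)))
        (<-≤-trans (+-mono-< h k) (≤-reflexive (half+half ε)))

    *-mono-≤-0 : ∀ {a b c d} → 0ℚ ≤ b → 0ℚ ≤ c → a ≤ c → b ≤ d → a * b ≤ c * d
    *-mono-≤-0 {a} {b} {c} {d} 0≤b 0≤c a≤c b≤d =
      ≤-trans (*-monoʳ-≤-nonNeg b {{nonNegative 0≤b}} a≤c) (*-monoˡ-≤-nonNeg c {{nonNegative 0≤c}} b≤d)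

    dist-*-< : ∀ {ε B} → 0ℚ < ε → 0ℚ < B → ∃[ δ ] 0ℚ < δ × (∀ p p′ q q′ →
               ∣ p ∣ < B → ∣ q′ ∣ < B → dist p p′ < δ → dist q q′ < δ → dist (p * q) (p′ * q′) < ε)
    dist-*-< {ε} {B} 0<ε 0<B with 1/-pos 0<B
    ... | C , 0<C , BC≡1 = δ , half-pos (*-pos 0<ε 0<C) , bound
      where
      δ : ℚ
      δ = half (ε * C)
      Bδ : B * δ ≡ half ε
      Bδ = trans (solve 4 (λ h B ε C → B :* (h :* (ε :* C)) := h :* (ε :* (B :* C))) refl ½ B ε C)
                 (trans (cong (λ z → ½ * (ε * z)) BC≡1) (cong (½ *_) (*-identityʳ ε)))
      term : ∀ {u v} → ∣ u ∣ < B → ∣ v ∣ < δ → ∣ u * v ∣ < half ε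
      term {u} {v} hu hv =
        ≤-<-trans
          (≤-trans (≤-reflexive (∣p*q∣≡∣p∣*∣q∣ u v))
                   (*-monoʳ-≤-nonNeg ∣ v ∣ {{nonNegative (0≤∣p∣ v)}} (<⇒≤ hu)))
          (<-≤-trans (*-monoʳ-<-pos B {{positive 0<B}} hv) (≤-reflexive Bδ))
      bound : ∀ p p′ q q′ → ∣ p ∣ < B → ∣ q′ ∣ < B → dist p p′ < δ → dist q q′ < δ →
              dist (p * q) (p′ * q′) < ε
      bound p p′ q q′ hp hq′ hpp′ hqq′ =
        ≤-<-trans
          (≤-trans
            (≤-reflexive (cong ∣_∣ (solve 4 (λ p p′ q q′ → (p :* q) :- (p′ :* q′)
                                              := p :* (q :- q′) :+ q′ :* (p :- p′)) refl p p′ q q′)))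
            (∣p+q∣≤∣p∣+∣q∣ (p * (q - q′)) (q′ * (p - p′))))
          (<-≤-trans (+-mono-< (term hp hqq′) (term hq′ hpp′)) (≤-reflexive (half+half ε)))

    dist-near : ∀ {a b} p q p′ q′ → dist p q < a → dist p p′ < b → dist q q′ < b →
                dist p′ q′ < (b + b) + a
    dist-near {a} {b} p q p′ q′ h hp hq =
      ≤-<-trans
        (≤-trans (dist-tri p′ p q′) (≤-trans (+-monoʳ-≤ (dist p′ p) (dist-tri p q q′))
          (≤-reflexive (solve 3 (λ x y z → x :+ (y :+ z) := (x :+ z) :+ y) refl
                                (dist p′ p) (dist p q) (dist q q′)))))
        (+-mono-< (+-mono-< (subst (_< b) (dist-sym p p′) hp) hq) h)

    dist-far : ∀ {ε} p q p′ q′ → ε ≤ dist p q → dist p p′ < half (half ε) → dist q q′ < half (half ε) →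
               half ε ≤ dist p′ q′
    dist-far {ε} p q p′ q′ far hp hq = ≮⇒≥ λ near → <-irrefl refl (<-≤-trans
      (dist-near p′ q′ p q near (subst (_< half (half ε)) (dist-sym p p′) hp)
                                (subst (_< half (half ε)) (dist-sym q q′) hq))
      (≤-trans (≤-reflexive (trans (cong (_+ half ε) (half+half (half ε))) (half+half ε))) far))

    dist-close : ∀ {ε} p q p′ q′ → 0ℚ < ε → dist p q < half ε →
                 dist p p′ < half (half (half ε)) → dist q q′ < half (half (half ε)) → dist p′ q′ < ε
    dist-close {ε} p q p′ q′ 0<ε h hp hq = <-≤-trans (dist-near p q p′ q′ h hp hq)
      (≤-trans (≤-reflexive (cong (_+ half ε) (half+half (half (half ε)))))
      (≤-trans (+-monoˡ-≤ (half ε) (<⇒≤ half-<)) (≤-reflexive (half+half ε))))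
      where
      half-< : half (half ε) < half ε
      half-< = subst₂ _<_ (+-identityʳ (half (half ε))) (half+half (half ε))
                      (+-monoʳ-< (half (half ε)) (half-pos (half-pos 0<ε)))

    dist-split : ∀ {ε} p q r → ε ≤ dist p q → half ε ≤ dist p r ⊎ half ε ≤ dist r q
    dist-split {ε} p q r far with half ε ≤? dist p r | half ε ≤? dist r q
    ... | yes h | _     = inj₁ h
    ... | no _  | yes h = inj₂ h
    ... | no h  | no k  = ⊥-elim (<-irrefl refl (<-≤-trans (dist-trans-< p r q (≰⇒> h) (≰⇒> k)) far))

    sq≡∣∣² : ∀ p → p * p ≡ ∣ p ∣ * ∣ p ∣
    sq≡∣∣² p with ∣p∣≡p∨∣p∣≡-p p
    ... | inj₁ e rewrite e = refl
    ... | inj₂ e rewrite e = solve 1 (λ p → p :* p := (:- p) :* (:- p)) refl p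

    0≤sq : ∀ p → 0ℚ ≤ p * p
    0≤sq p = subst (0ℚ ≤_) (sym (sq≡∣∣² p))
      (subst (_≤ ∣ p ∣ * ∣ p ∣) (*-zeroʳ ∣ p ∣)
        (*-monoˡ-≤-nonNeg ∣ p ∣ {{nonNegative (0≤∣p∣ p)}} (0≤∣p∣ p)))

    ε²≤sq : ∀ {ε} p → 0ℚ < ε → ε ≤ dist p 0ℚ → ε * ε ≤ p * p
    ε²≤sq {ε} p 0<ε h = subst (ε * ε ≤_) (sym (sq≡∣∣² p)) (*-mono-≤-0 (<⇒≤ 0<ε) (0≤∣p∣ p) h′ h′)
      where
      h′ : ε ≤ ∣ p ∣
      h′ = subst (ε ≤_) (dist-0 p) h

    far-+ : ∀ {ε p} q → ε ≤ p → 0ℚ ≤ q → ε ≤ dist (p + q) 0ℚ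
    far-+ {ε} {p} q h 0≤q = ≤-trans
      (≤-trans (subst (_≤ p + 0ℚ) (+-identityʳ ε) (+-monoˡ-≤ 0ℚ h)) (+-monoʳ-≤ p 0≤q))
      (≤-trans (p≤∣p∣ (p + q)) (≤-reflexive (sym (dist-0 (p + q)))))
      where
      p≤∣p∣ : ∀ p → p ≤ ∣ p ∣
      p≤∣p∣ p with ≤-total 0ℚ p
      ... | inj₁ 0≤p = ≤-reflexive (sym (0≤p⇒∣p∣≡p 0≤p))
      ... | inj₂ p≤0 = ≤-trans p≤0 (0≤∣p∣ p)

    far-factor : ∀ {ε B C} p q → 0ℚ < B → B * C ≡ 1ℚ → ∣ q ∣ < B → ε ≤ dist (p * q) 0ℚ →
                 ε * C ≤ dist p 0ℚ
    far-factor {ε} {B} {C} p q 0<B BC≡1 hq h = ≮⇒≥ λ near → <-irrefl refl (<-≤-trans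
      (≤-<-trans (*-monoˡ-≤-nonNeg ∣ p ∣ {{nonNegative (0≤∣p∣ p)}} (<⇒≤ hq))
        (<-≤-trans (*-monoˡ-<-pos B {{positive 0<B}} (subst (_< ε * C) (dist-0 p) near))
                   (≤-reflexive (trans (solve 3 (λ ε C B → (ε :* C) :* B := ε :* (B :* C)) refl ε C B)
                                       (trans (cong (ε *_) BC≡1) (*-identityʳ ε))))))
      (subst (ε ≤_) (trans (dist-0 (p * q)) (∣p*q∣≡∣p∣*∣q∣ p q)) h))

    inv : ℚ → ℚ
    inv p with p ≟ 0ℚ
    ... | yes _   = 0ℚ
    ... | no  p≢0 = (1/ p) {{≢-nonZero p≢0}}

    inv-inverse : ∀ p → p ≢ 0ℚ → p * inv p ≡ 1ℚ
    inv-inverse p p≢0 with p ≟ 0ℚ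
    ... | yes p≡0 = ⊥-elim (p≢0 p≡0)
    ... | no  p≢0 = *-inverseʳ p {{≢-nonZero p≢0}}

    far-0 : ∀ {ε p} → 0ℚ < ε → ε ≤ dist p 0ℚ → p ≢ 0ℚ
    far-0 0<ε h refl = <-irrefl refl (<-≤-trans 0<ε h)

    dist-inv-< : ∀ {ε η} p q → 0ℚ < ε → ε ≤ dist p 0ℚ → ε ≤ dist q 0ℚ →
                 dist p q < η * (ε * ε) → dist (inv p) (inv q) < η
    dist-inv-< {ε} {η} p q 0<ε hp hq h =
      *-cancelʳ-<-nonNeg (ε * ε) {{nonNegative (<⇒≤ 0<ε²)}} (≤-<-trans (≤-trans
        (*-monoˡ-≤-nonNeg (dist ip iq) {{nonNegative (0≤∣p∣ (ip - iq))}}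
          (*-mono-≤-0 (<⇒≤ 0<ε) (0≤∣p∣ p) (subst (ε ≤_) (dist-0 p) hp) (subst (ε ≤_) (dist-0 q) hq)))
        (≤-reflexive scaled)) h)
      where
      ip iq : ℚ
      ip = inv p
      iq = inv q
      0<ε² : 0ℚ < ε * ε
      0<ε² = *-pos 0<ε 0<ε
      diff : (ip - iq) * (p * q) ≡ q - p
      diff = trans
        (solve 4 (λ ip iq p q → (ip :- iq) :* (p :* q) := q :* (p :* ip) :- p :* (q :* iq)) refl ip iq p q)
        (cong₂ (λ u v → q * u - p * v) (inv-inverse p (far-0 0<ε hp)) (inv-inverse q (far-0 0<ε hq))
         ∙ cong₂ _-_ (*-identityʳ q) (*-identityʳ p))
        where
        infixr 5 _∙_
        _∙_ : ∀ {a b c : ℚ} → a ≡ b → b ≡ c → a ≡ c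
        _∙_ = trans
      scaled : dist ip iq * (∣ p ∣ * ∣ q ∣) ≡ dist p q
      scaled = trans (cong (dist ip iq *_) (sym (∣p*q∣≡∣p∣*∣q∣ p q)))
        (trans (sym (∣p*q∣≡∣p∣*∣q∣ (ip - iq) (p * q))) (trans (cong ∣_∣ diff) (dist-sym q p)))

    -- Over ℚ, the identities behind associativity and distributivity of complex multiplication;
    -- the solver is only used for linear rearrangements, since it is slow on six-variable products.

    private
      shuffle₁ : ∀ p q r s → (p - q) - (r + s) ≡ (p - r) - (s + q)
      shuffle₁ = solve 4 (λ p q r s → (p :- q) :- (r :+ s) := (p :- r) :- (s :+ q)) refl

      shuffle₂ : ∀ p q r s → (p - q) + (r + s) ≡ (p + r) + (s - q)
      shuffle₂ = solve 4 (λ p q r s → (p :- q) :+ (r :+ s) := (p :+ r) :+ (s :- q)) refl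

      shuffle₃ : ∀ p q r s → (p + q) - (r + s) ≡ (p - r) + (q - s)
      shuffle₃ = solve 4 (λ p q r s → (p :+ q) :- (r :+ s) := (p :- r) :+ (q :- s)) refl

      shuffle₄ : ∀ p q r s → (p + q) + (r + s) ≡ (p + r) + (q + s)
      shuffle₄ = solve 4 (λ p q r s → (p :+ q) :+ (r :+ s) := (p :+ r) :+ (q :+ s)) refl

      distribʳ- : ∀ p q r → (p - q) * r ≡ p * r - q * r
      distribʳ- p q r = trans (*-distribʳ-+ r p (- q)) (cong (p * r +_) (sym (neg-distribˡ-* q r)))

      distribˡ- : ∀ p q r → p * (q - r) ≡ p * q - p * r
      distribˡ- p q r = trans (*-distribˡ-+ p q (- r)) (cong (p * q +_) (sym (neg-distribʳ-* p r)))

      assoc-- : ∀ a c b d e → (a * c - b * d) * e ≡ a * (c * e) - b * (d * e)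
      assoc-- a c b d e = trans (distribʳ- (a * c) (b * d) e) (cong₂ _-_ (*-assoc a c e) (*-assoc b d e))

      assoc-+ : ∀ a c b d e → (a * c + b * d) * e ≡ a * (c * e) + b * (d * e)
      assoc-+ a c b d e =
        trans (*-distribʳ-+ e (a * c) (b * d)) (cong₂ _+_ (*-assoc a c e) (*-assoc b d e))

    ℚ-re-assoc : ∀ a b c d e f → (a * c - b * d) * e - (a * d + b * c) * f
                               ≡ a * (c * e - d * f) - b * (c * f + d * e)
    ℚ-re-assoc a b c d e f =
      trans (cong₂ _-_ (assoc-- a c b d e) (assoc-+ a d b c f))
      (trans (shuffle₁ (a * (c * e)) (b * (d * e)) (a * (d * f)) (b * (c * f)))
      (sym (cong₂ _-_ (distribˡ- a (c * e) (d * f)) (*-distribˡ-+ b (c * f) (d * e)))))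

    ℚ-im-assoc : ∀ a b c d e f → (a * c - b * d) * f + (a * d + b * c) * e
                               ≡ a * (c * f + d * e) + b * (c * e - d * f)
    ℚ-im-assoc a b c d e f =
      trans (cong₂ _+_ (assoc-- a c b d f) (assoc-+ a d b c e))
      (trans (shuffle₂ (a * (c * f)) (b * (d * f)) (a * (d * e)) (b * (c * e)))
      (sym (cong₂ _+_ (*-distribˡ-+ a (c * f) (d * e)) (distribˡ- b (c * e) (d * f)))))

    ℚ-re-distribˡ : ∀ a b c d e f → a * (c + e) - b * (d + f) ≡ (a * c - b * d) + (a * e - b * f)
    ℚ-re-distribˡ a b c d e f =
      trans (cong₂ _-_ (*-distribˡ-+ a c e) (*-distribˡ-+ b d f))
            (shuffle₃ (a * c) (a * e) (b * d) (b * f))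

    ℚ-im-distribˡ : ∀ a b c d e f → a * (d + f) + b * (c + e) ≡ (a * d + b * c) + (a * f + b * e)
    ℚ-im-distribˡ a b c d e f =
      trans (cong₂ _+_ (*-distribˡ-+ a d f) (*-distribˡ-+ b c e))
            (shuffle₄ (a * d) (a * f) (b * c) (b * e))

-- Cauchy reals: a Cauchy sequence of rationals carries its modulus of convergence as data.
module RealNumbers where

  open RationalArithmetic
  open import Data.Rational.Base as ℚ using (ℚ; 0ℚ; 1ℚ; ∣_∣; _<_; _≤_)
  import Data.Rational.Properties as ℚ
  open import Data.Rational.Solver using (module +-*-Solver)
  import Data.Nat.Properties as ℕ
  open import Data.Product.Base using (∃-syntax; _×_; _,_; proj₁; proj₂)
  open import Data.Sum.Base as Sum using (_⊎_; inj₁; inj₂)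
  open import Data.Empty using (⊥-elim)
  open import Relation.Binary.Structures using (IsEquivalence; IsApartnessRelation)
  open import Relation.Nullary using (¬_)
  open import Relation.Binary.PropositionalEquality as ≡ using (_≡_)
  open +-*-Solver

  IsCauchy : (ℕ → ℚ) → Set
  IsCauchy s = ∀ ε → 0ℚ < ε → ∃[ N ] ∀ m n → N ℕ.≤ m → N ℕ.≤ n → dist (s m) (s n) < ε

  record ℝ : Set where
    constructor mkℝ
    field
      seq    : ℕ → ℚ
      cauchy : IsCauchy seq

  open ℝ public

  Eventually : (ℕ → Set) → Set
  Eventually P = ∃[ N ] ∀ n → N ℕ.≤ n → P n

  infix 4 _≈_ _#_

  record _≈_ (x y : ℝ) : Set where
    constructor mk≈
    field close : ∀ ε → 0ℚ < ε → Eventually λ n → dist (seq x n) (seq y n) < ε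

  open _≈_

  -- Inequality in its positive form; x ≈ y is equivalent to ¬ x # y.
  record _#_ (x y : ℝ) : Set where
    constructor mk#
    field
      gap      : ℚ
      positive : 0ℚ < gap
      apart    : Eventually λ n → gap ≤ dist (seq x n) (seq y n)

  private

    both : ∀ {P Q R : ℕ → Set} → (∀ n → P n → Q n → R n) → Eventually P → Eventually Q → Eventually R
    both f (M , p) (N , q) = M ℕ.⊔ N , λ n h →
      f n (p n (ℕ.≤-trans (ℕ.m≤m⊔n M N) h)) (q n (ℕ.≤-trans (ℕ.m≤n⊔m M N) h))

    every : ∀ {P Q : ℕ → Set} → (∀ n → P n → Q n) → Eventually P → Eventually Q
    every f (N , p) = N , λ n h → f n (p n h)

    pointwise : ∀ {x y} → (∀ n → seq x n ≡ seq y n) → x ≈ y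
    pointwise {x} {y} e = mk≈ λ ε 0<ε → 0 , λ n _ →
      ≡.subst (_< ε) (≡.trans (≡.sym (dist-self (seq x n))) (≡.cong (dist (seq x n)) (e n))) 0<ε

    abstract

      bounded : ∀ x → ∃[ B ] 0ℚ < B × Eventually λ n → ∣ seq x n ∣ < B
      bounded x with cauchy x 1ℚ (ℚ.positive⁻¹ 1ℚ)
      ... | N , c = B , ℚ.≤-<-trans (ℚ.0≤∣p∣ (seq x N)) ∣xN∣<B , N , λ n h →
        ℚ.≤-<-trans (≡.subst (_≤ dist (seq x N) (seq x n) ℚ.+ ∣ seq x N ∣) (∣split∣ (seq x n))
                       (≡.subst (λ d → ∣ (seq x n ℚ.- seq x N) ℚ.+ seq x N ∣ ≤ d ℚ.+ ∣ seq x N ∣)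
                                (dist-sym (seq x n) (seq x N))
                                (ℚ.∣p+q∣≤∣p∣+∣q∣ (seq x n ℚ.- seq x N) (seq x N))))
                    (ℚ.+-monoˡ-< ∣ seq x N ∣ (c N n ℕ.≤-refl h))
        where
        B : ℚ
        B = 1ℚ ℚ.+ ∣ seq x N ∣
        ∣xN∣<B : ∣ seq x N ∣ < B
        ∣xN∣<B = ≡.subst (_< B) (ℚ.+-identityˡ ∣ seq x N ∣) (ℚ.+-monoˡ-< ∣ seq x N ∣ (ℚ.positive⁻¹ 1ℚ))
        ∣split∣ : ∀ p → ∣ (p ℚ.- seq x N) ℚ.+ seq x N ∣ ≡ ∣ p ∣
        ∣split∣ p = ≡.cong ∣_∣ (solve 2 (λ p q → (p :- q) :+ q := p) ≡.refl p (seq x N))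

      jointBound : ∀ x y → ∃[ B ] 0ℚ < B × Eventually λ n → ∣ seq x n ∣ < B × ∣ seq y n ∣ < B
      jointBound x y =
        let (B , 0<B , b) = bounded x
            (C , 0<C , c) = bounded y
        in B ℚ.+ C , <-+ˡ 0ℚ B C 0<B 0<C ,
           both (λ n h k → (<-+ˡ ∣ seq x n ∣ B C h 0<C) , (<-+ʳ ∣ seq y n ∣ B C k 0<B)) b c

      cauchy² : ∀ x y δ → 0ℚ < δ → ∃[ N ] ∀ m n → N ℕ.≤ m → N ℕ.≤ n →
                dist (seq x m) (seq x n) < δ × dist (seq y m) (seq y n) < δ
      cauchy² x y δ 0<δ = let (M , c) = cauchy x δ 0<δ; (N , d) = cauchy y δ 0<δ in
        M ℕ.⊔ N , λ m n h k →
        c m n (ℕ.≤-trans (ℕ.m≤m⊔n M N) h) (ℕ.≤-trans (ℕ.m≤m⊔n M N) k) ,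
        d m n (ℕ.≤-trans (ℕ.m≤n⊔m M N) h) (ℕ.≤-trans (ℕ.m≤n⊔m M N) k)

  infix  8 -_
  infixl 7 _*_
  infixl 6 _+_

  const : ℚ → ℝ
  const q = mkℝ (λ _ → q) λ ε 0<ε → 0 , λ _ _ _ _ → ≡.subst (_< ε) (≡.sym (dist-self q)) 0<ε

  0ℝ 1ℝ : ℝ
  0ℝ = const 0ℚ
  1ℝ = const 1ℚ

  -_ : ℝ → ℝ
  - x = mkℝ (λ n → ℚ.- seq x n) isCauchy
    where
    abstract
      isCauchy : IsCauchy (λ n → ℚ.- seq x n)
      isCauchy ε 0<ε = let (N , c) = cauchy x ε 0<ε in
        N , λ m n h k → ≡.subst (_< ε) (≡.sym (dist-neg (seq x m) (seq x n))) (c m n h k)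

  _+_ : ℝ → ℝ → ℝ
  x + y = mkℝ (λ n → seq x n ℚ.+ seq y n) isCauchy
    where
    abstract
      isCauchy : IsCauchy (λ n → seq x n ℚ.+ seq y n)
      isCauchy ε 0<ε = let (N , c) = cauchy² x y (half ε) (half-pos 0<ε) in
        N , λ m n h k → let (p , q) = c m n h k in
        dist-+-< (seq x m) (seq x n) (seq y m) (seq y n) p q

  _*_ : ℝ → ℝ → ℝ
  x * y = mkℝ (λ n → seq x n ℚ.* seq y n) isCauchy
    where
    abstract
      isCauchy : IsCauchy (λ n → seq x n ℚ.* seq y n)
      isCauchy ε 0<ε =
        let (B , 0<B , M , b)   = jointBound x y
            (δ , 0<δ , estimate) = dist-*-< 0<ε 0<B
            (N , c)             = cauchy² x y δ 0<δ
        in M ℕ.⊔ N , λ m n h k →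
        let (bx , _) = b m (ℕ.≤-trans (ℕ.m≤m⊔n M N) h)
            (_ , by) = b n (ℕ.≤-trans (ℕ.m≤m⊔n M N) k)
            (p , q)  = c m n (ℕ.≤-trans (ℕ.m≤n⊔m M N) h) (ℕ.≤-trans (ℕ.m≤n⊔m M N) k)
        in estimate (seq x m) (seq x n) (seq y m) (seq y n) bx by p q

  abstract

    ≈-isEquivalence : IsEquivalence _≈_
    ≈-isEquivalence = record
      { refl  = pointwise λ _ → ≡.refl
      ; sym   = λ {x} {y} x≈y → mk≈ λ ε 0<ε →
          every (λ n → ≡.subst (_< ε) (dist-sym (seq x n) (seq y n))) (close x≈y ε 0<ε)
      ; trans = λ {x} {y} {z} x≈y y≈z → mk≈ λ ε 0<ε →
          both (λ n → dist-trans-< (seq x n) (seq y n) (seq z n))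
               (close x≈y (half ε) (half-pos 0<ε)) (close y≈z (half ε) (half-pos 0<ε))
      }

    -‿cong : ∀ {x x′} → x ≈ x′ → - x ≈ - x′
    -‿cong {x} {x′} p = mk≈ λ ε 0<ε →
      every (λ n → ≡.subst (_< ε) (≡.sym (dist-neg (seq x n) (seq x′ n)))) (close p ε 0<ε)

    +-cong : ∀ {x x′ y y′} → x ≈ x′ → y ≈ y′ → x + y ≈ x′ + y′
    +-cong {x} {x′} {y} {y′} p q = mk≈ λ ε 0<ε →
      both (λ n → dist-+-< (seq x n) (seq x′ n) (seq y n) (seq y′ n))
           (close p (half ε) (half-pos 0<ε)) (close q (half ε) (half-pos 0<ε))

    *-cong : ∀ {x x′ y y′} → x ≈ x′ → y ≈ y′ → x * y ≈ x′ * y′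
    *-cong {x} {x′} {y} {y′} p q = mk≈ λ ε 0<ε → *-close ε 0<ε
      where
      *-close : ∀ ε → 0ℚ < ε → Eventually λ n → dist (seq (x * y) n) (seq (x′ * y′) n) < ε
      *-close ε 0<ε =
        let (B , 0<B , b)       = jointBound x y′
            (δ , 0<δ , estimate) = dist-*-< 0<ε 0<B
        in
        both (λ n (bx , by) (h , k) → estimate (seq x n) (seq x′ n) (seq y n) (seq y′ n) bx by h k)
             b (both (λ _ → _,_) (close p δ 0<δ) (close q δ 0<δ))

    +-assoc : ∀ x y z → (x + y) + z ≈ x + (y + z)
    +-assoc x y z = pointwise λ n → ℚ.+-assoc (seq x n) (seq y n) (seq z n)

    +-comm : ∀ x y → x + y ≈ y + x
    +-comm x y = pointwise λ n → ℚ.+-comm (seq x n) (seq y n)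

    +-identityˡ : ∀ x → 0ℝ + x ≈ x
    +-identityˡ x = pointwise λ n → ℚ.+-identityˡ (seq x n)

    +-inverseˡ : ∀ x → - x + x ≈ 0ℝ
    +-inverseˡ x = pointwise λ n → ℚ.+-inverseˡ (seq x n)

    mul-zeroˡ : ∀ x → 0ℝ * x ≈ 0ℝ
    mul-zeroˡ x = pointwise λ n → ℚ.*-zeroˡ (seq x n)

    -- Componentwise laws of complex multiplication, checked termwise over ℚ.

    re-assoc : ∀ a b c d e f → (a * c + - (b * d)) * e + - ((a * d + b * c) * f)
                             ≈ a * (c * e + - (d * f)) + - (b * (c * f + d * e))
    re-assoc a b c d e f = pointwise λ n →
      ℚ-re-assoc (seq a n) (seq b n) (seq c n) (seq d n) (seq e n) (seq f n)

    im-assoc : ∀ a b c d e f → (a * c + - (b * d)) * f + (a * d + b * c) * e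
                             ≈ a * (c * f + d * e) + b * (c * e + - (d * f))
    im-assoc a b c d e f = pointwise λ n →
      ℚ-im-assoc (seq a n) (seq b n) (seq c n) (seq d n) (seq e n) (seq f n)

    re-comm : ∀ a b c d → a * c + - (b * d) ≈ c * a + - (d * b)
    re-comm a b c d = pointwise λ n → solve 4
      (λ a b c d → a :* c :+ :- (b :* d) := c :* a :+ :- (d :* b))
      ≡.refl (seq a n) (seq b n) (seq c n) (seq d n)

    im-comm : ∀ a b c d → a * d + b * c ≈ c * b + d * a
    im-comm a b c d = pointwise λ n → solve 4
      (λ a b c d → a :* d :+ b :* c := c :* b :+ d :* a)
      ≡.refl (seq a n) (seq b n) (seq c n) (seq d n)

    re-identityˡ : ∀ a b → 1ℝ * a + - (0ℝ * b) ≈ a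
    re-identityˡ a b = pointwise λ n → solve 2
      (λ a b → con 1ℚ :* a :+ :- (con 0ℚ :* b) := a) ≡.refl (seq a n) (seq b n)

    im-identityˡ : ∀ a b → 1ℝ * b + 0ℝ * a ≈ b
    im-identityˡ a b = pointwise λ n → solve 2
      (λ a b → con 1ℚ :* b :+ con 0ℚ :* a := b) ≡.refl (seq a n) (seq b n)

    re-distribˡ : ∀ a b c d e f → a * (c + e) + - (b * (d + f))
                                ≈ (a * c + - (b * d)) + (a * e + - (b * f))
    re-distribˡ a b c d e f = pointwise λ n →
      ℚ-re-distribˡ (seq a n) (seq b n) (seq c n) (seq d n) (seq e n) (seq f n)

    im-distribˡ : ∀ a b c d e f → a * (d + f) + b * (c + e)
                                ≈ (a * d + b * c) + (a * f + b * e)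
    im-distribˡ a b c d e f = pointwise λ n →
      ℚ-im-distribˡ (seq a n) (seq b n) (seq c n) (seq d n) (seq e n) (seq f n)

    -- The two components of (a + ib) · (at - ibt) = (a² + b²) t.

    re-conjugate : ∀ a b t → a * (a * t) + - (b * - (b * t)) ≈ (a * a + b * b) * t
    re-conjugate a b t = pointwise λ n → solve 3
      (λ a b t → a :* (a :* t) :+ :- (b :* :- (b :* t)) := (a :* a :+ b :* b) :* t)
      ≡.refl (seq a n) (seq b n) (seq t n)

    im-conjugate : ∀ a b t → a * - (b * t) + b * (a * t) ≈ 0ℝ
    im-conjugate a b t = pointwise λ n → solve 3
      (λ a b t → a :* :- (b :* t) :+ b :* (a :* t) := con 0ℚ)
      ≡.refl (seq a n) (seq b n) (seq t n)

    #-irrefl : ∀ {x y} → x ≈ y → ¬ x # y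
    #-irrefl x≈y (mk# ε 0<ε apart) =
      let (N , absurd) = both (λ _ → ℚ.≤-<-trans) apart (close x≈y ε 0<ε) in
      ℚ.<-irrefl ≡.refl (absurd N ℕ.≤-refl)

    #-sym : ∀ {x y} → x # y → y # x
    #-sym {x} {y} (mk# ε 0<ε apart) =
      mk# ε 0<ε (every (λ n → ≡.subst (ε ≤_) (dist-sym (seq x n) (seq y n))) apart)

    private
      far⇒# : ∀ x y {N ε} → 0ℚ < ε → ε ≤ dist (seq x N) (seq y N) →
              (∀ n → N ℕ.≤ n → dist (seq x N) (seq x n) < half (half ε)) →
              (∀ n → N ℕ.≤ n → dist (seq y N) (seq y n) < half (half ε)) → x # y
      far⇒# x y {N} {ε} 0<ε far cx cy = mk# (half ε) (half-pos 0<ε) (N , λ n h →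
        dist-far (seq x N) (seq y N) (seq x n) (seq y n) far (cx n h) (cy n h))

    #-cotrans : ∀ {x y} → x # y → ∀ z → x # z ⊎ z # y
    #-cotrans {x} {y} (mk# ε 0<ε (K , apart)) z = go (cauchy² x y δ 0<δ) (cauchy z δ 0<δ)
      where
      δ : ℚ
      δ = half (half (half ε))
      0<δ : 0ℚ < δ
      0<δ = half-pos (half-pos (half-pos 0<ε))
      go : (∃[ N ] ∀ m n → N ℕ.≤ m → N ℕ.≤ n →
              dist (seq x m) (seq x n) < δ × dist (seq y m) (seq y n) < δ) →
           (∃[ N ] ∀ m n → N ℕ.≤ m → N ℕ.≤ n → dist (seq z m) (seq z n) < δ) → x # z ⊎ z # y
      go (M , c) (N , d) =
        Sum.map (λ h → far⇒# x z (half-pos 0<ε) h cx cz) (λ h → far⇒# z y (half-pos 0<ε) h cz cy)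
                (dist-split (seq x L) (seq y L) (seq z L) (apart L (ℕ.m≤m⊔n K (M ℕ.⊔ N))))
        where
        L : ℕ
        L = K ℕ.⊔ (M ℕ.⊔ N)
        M≤L : M ℕ.≤ L
        M≤L = ℕ.≤-trans (ℕ.m≤m⊔n M N) (ℕ.m≤n⊔m K (M ℕ.⊔ N))
        N≤L : N ℕ.≤ L
        N≤L = ℕ.≤-trans (ℕ.m≤n⊔m M N) (ℕ.m≤n⊔m K (M ℕ.⊔ N))
        cx : ∀ n → L ℕ.≤ n → dist (seq x L) (seq x n) < δ
        cx n h = proj₁ (c L n M≤L (ℕ.≤-trans M≤L h))
        cy : ∀ n → L ℕ.≤ n → dist (seq y L) (seq y n) < δ
        cy n h = proj₂ (c L n M≤L (ℕ.≤-trans M≤L h))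
        cz : ∀ n → L ℕ.≤ n → dist (seq z L) (seq z n) < δ
        cz n h = d L n N≤L (ℕ.≤-trans N≤L h)

    #-tight : ∀ {x y} → ¬ x # y → x ≈ y
    #-tight {x} {y} ¬x#y = mk≈ go
      where
      go : ∀ ε → 0ℚ < ε → Eventually λ n → dist (seq x n) (seq y n) < ε
      go ε 0<ε =
        let (N , c) = cauchy² x y (half (half (half ε))) (half-pos (half-pos (half-pos 0<ε))) in
        N , λ n h →
          dist-close (seq x N) (seq y N) (seq x n) (seq y n) 0<ε
            (ℚ.≰⇒> λ far → ¬x#y (far⇒# x y (half-pos 0<ε) far
              (λ n h → proj₁ (c N n ℕ.≤-refl h)) (λ n h → proj₂ (c N n ℕ.≤-refl h))))
            (proj₁ (c N n ℕ.≤-refl h)) (proj₂ (c N n ℕ.≤-refl h))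

    #-respˡ-≈ : ∀ {x y z} → x ≈ y → x # z → y # z
    #-respˡ-≈ {y = y} x≈y x#z with #-cotrans x#z y
    ... | inj₁ x#y = ⊥-elim (#-irrefl x≈y x#y)
    ... | inj₂ y#z = y#z

    1#0 : 1ℝ # 0ℝ
    1#0 = mk# 1ℚ (ℚ.positive⁻¹ 1ℚ) (0 , λ _ _ → ℚ.≤-refl)

    #⇒-#0 : ∀ {x y} → x # y → x + - y # 0ℝ
    #⇒-#0 {x} {y} (mk# ε 0<ε apart) =
      mk# ε 0<ε (every (λ n → ≡.subst (ε ≤_) (≡.sym (dist-minus (seq x n) (seq y n)))) apart)

    -#0⇒# : ∀ {x y} → x + - y # 0ℝ → x # y
    -#0⇒# {x} {y} (mk# ε 0<ε apart) =
      mk# ε 0<ε (every (λ n → ≡.subst (ε ≤_) (dist-minus (seq x n) (seq y n))) apart)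

    *#0⇒#0 : ∀ {x y} → x * y # 0ℝ → x # 0ℝ
    *#0⇒#0 {x} {y} (mk# ε 0<ε apart) =
      let (B , 0<B , b)    = bounded y
          (C , 0<C , BC≡1) = 1/-pos 0<B
      in mk# (ε ℚ.* C) (*-pos 0<ε 0<C)
           (both (λ n → far-factor (seq x n) (seq y n) 0<B BC≡1) b apart)

    #0⇒sumOfSquares#0 : ∀ x y → x # 0ℝ ⊎ y # 0ℝ → x * x + y * y # 0ℝ
    #0⇒sumOfSquares#0 x y (inj₁ (mk# ε 0<ε apart)) = mk# (ε ℚ.* ε) (*-pos 0<ε 0<ε)
      (every (λ n h → far-+ (seq y n ℚ.* seq y n) (ε²≤sq (seq x n) 0<ε h) (0≤sq (seq y n))) apart)
    #0⇒sumOfSquares#0 x y (inj₂ (mk# ε 0<ε apart)) =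
      #-respˡ-≈ (+-comm (y * y) (x * x)) (mk# (ε ℚ.* ε) (*-pos 0<ε 0<ε)
        (every (λ n h → far-+ (seq x n ℚ.* seq x n) (ε²≤sq (seq y n) 0<ε h) (0≤sq (seq x n))) apart))

    reciprocal : ∀ {x} → x # 0ℝ → ∃[ t ] x * t ≈ 1ℝ
    reciprocal {x} (mk# ε 0<ε (K , apart)) =
      mkℝ (λ n → inv (seq x n)) isCauchy , mk≈ λ η 0<η → K , λ n h →
        ≡.subst (_< η)
          (≡.trans (≡.sym (dist-self 1ℚ))
                   (≡.cong (λ p → dist p 1ℚ) (≡.sym (inv-inverse (seq x n) (far-0 0<ε (apart n h))))))
          0<η
      where
      isCauchy : IsCauchy (λ n → inv (seq x n))
      isCauchy η 0<η = let (N , c) = cauchy x (η ℚ.* (ε ℚ.* ε)) (*-pos 0<η (*-pos 0<ε 0<ε)) in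
        K ℕ.⊔ N , λ m n h k →
        dist-inv-< (seq x m) (seq x n) 0<ε
          (apart m (ℕ.≤-trans (ℕ.m≤m⊔n K N) h)) (apart n (ℕ.≤-trans (ℕ.m≤m⊔n K N) k))
          (c m n (ℕ.≤-trans (ℕ.m≤n⊔m K N) h) (ℕ.≤-trans (ℕ.m≤n⊔m K N) k))

module ComplexNumbers where

  open import Algebra.Apartness.Structures using (IsHeytingField)
  open import Algebra.Definitions using (Invertible)
  open import Data.Product.Base using (_,_)
  open import Data.Sum.Base as Sum using (_⊎_; inj₁; inj₂)
  open import Relation.Binary.Structures using (IsEquivalence)
  open import Relation.Nullary using (¬_)
  open RealNumbers using (ℝ; 0ℝ; 1ℝ)
  private module R = RealNumbers
  private module ≈ᴿ = IsEquivalence R.≈-isEquivalence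

  infixr 5 _+i_

  record ℂ : Set where
    constructor _+i_
    field re im : ℝ

  open ℂ public

  infix  4 _≈_ _#_
  infix  8 -_
  infixl 7 _*_
  infixl 6 _+_ _-_

  record _≈_ (z w : ℂ) : Set where
    constructor mk≈
    field
      re≈ : re z R.≈ re w
      im≈ : im z R.≈ im w

  open _≈_ public

  record _#_ (z w : ℂ) : Set where
    constructor mk#
    field re#⊎im# : re z R.# re w ⊎ im z R.# im w

  open _#_ public

  0ℂ 1ℂ : ℂ
  0ℂ = 0ℝ +i 0ℝ
  1ℂ = 1ℝ +i 0ℝ

  _+_ : ℂ → ℂ → ℂ
  (a +i b) + (c +i d) = (a R.+ c) +i (b R.+ d)

  -_ : ℂ → ℂ
  - (a +i b) = (R.- a) +i (R.- b)

  _-_ : ℂ → ℂ → ℂ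
  z - w = z + - w

  _*_ : ℂ → ℂ → ℂ
  (a +i b) * (c +i d) = (a R.* c R.+ R.- (b R.* d)) +i (a R.* d R.+ b R.* c)

  private abstract

    ≈-isEquivalence : IsEquivalence _≈_
    ≈-isEquivalence = record
      { refl  = mk≈ ≈ᴿ.refl ≈ᴿ.refl
      ; sym   = λ (mk≈ p q) → mk≈ (≈ᴿ.sym p) (≈ᴿ.sym q)
      ; trans = λ (mk≈ p q) (mk≈ p′ q′) → mk≈ (≈ᴿ.trans p p′) (≈ᴿ.trans q q′)
      }

    ≈-trans : ∀ {x y z} → x ≈ y → y ≈ z → x ≈ z
    ≈-trans = IsEquivalence.trans ≈-isEquivalence

    +-cong : ∀ {x y u v} → x ≈ y → u ≈ v → x + u ≈ y + v
    +-cong (mk≈ p q) (mk≈ p′ q′) = mk≈ (R.+-cong p p′) (R.+-cong q q′)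

    *-cong : ∀ {x y u v} → x ≈ y → u ≈ v → x * u ≈ y * v
    *-cong (mk≈ p q) (mk≈ p′ q′) = mk≈
      (R.+-cong (R.*-cong p p′) (R.-‿cong (R.*-cong q q′)))
      (R.+-cong (R.*-cong p q′) (R.*-cong q p′))

    -‿cong : ∀ {x y} → x ≈ y → - x ≈ - y
    -‿cong (mk≈ p q) = mk≈ (R.-‿cong p) (R.-‿cong q)

    +-assoc : ∀ x y z → (x + y) + z ≈ x + (y + z)
    +-assoc (a +i b) (c +i d) (e +i f) = mk≈ (R.+-assoc a c e) (R.+-assoc b d f)

    +-comm : ∀ x y → x + y ≈ y + x
    +-comm (a +i b) (c +i d) = mk≈ (R.+-comm a c) (R.+-comm b d)

    +-identityˡ : ∀ x → 0ℂ + x ≈ x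
    +-identityˡ (a +i b) = mk≈ (R.+-identityˡ a) (R.+-identityˡ b)

    -‿inverseˡ : ∀ x → - x + x ≈ 0ℂ
    -‿inverseˡ (a +i b) = mk≈ (R.+-inverseˡ a) (R.+-inverseˡ b)

    *-assoc : ∀ x y z → (x * y) * z ≈ x * (y * z)
    *-assoc (a +i b) (c +i d) (e +i f) = mk≈ (R.re-assoc a b c d e f) (R.im-assoc a b c d e f)

    *-comm : ∀ x y → x * y ≈ y * x
    *-comm (a +i b) (c +i d) = mk≈ (R.re-comm a b c d) (R.im-comm a b c d)

    *-identityˡ : ∀ x → 1ℂ * x ≈ x
    *-identityˡ (a +i b) = mk≈ (R.re-identityˡ a b) (R.im-identityˡ a b)

    *-distribˡ-+ : ∀ x y z → x * (y + z) ≈ x * y + x * z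
    *-distribˡ-+ (a +i b) (c +i d) (e +i f) =
      mk≈ (R.re-distribˡ a b c d e f) (R.im-distribˡ a b c d e f)

    *-distribʳ-+ : ∀ x y z → (y + z) * x ≈ y * x + z * x
    *-distribʳ-+ x y z =
      ≈-trans (*-comm (y + z) x) (≈-trans (*-distribˡ-+ x y z) (+-cong (*-comm x y) (*-comm x z)))

    #-irrefl : ∀ {x y} → x ≈ y → ¬ x # y
    #-irrefl (mk≈ p q) (mk# (inj₁ h)) = R.#-irrefl p h
    #-irrefl (mk≈ p q) (mk# (inj₂ h)) = R.#-irrefl q h

    #-sym : ∀ {x y} → x # y → y # x
    #-sym (mk# h) = mk# (Sum.map R.#-sym R.#-sym h)

    #-cotrans : ∀ {x y} → x # y → ∀ z → x # z ⊎ z # y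
    #-cotrans (mk# (inj₁ h)) z =
      Sum.map (λ k → mk# (inj₁ k)) (λ k → mk# (inj₁ k)) (R.#-cotrans h (re z))
    #-cotrans (mk# (inj₂ h)) z =
      Sum.map (λ k → mk# (inj₂ k)) (λ k → mk# (inj₂ k)) (R.#-cotrans h (im z))

    #-tight : ∀ {x y} → ¬ x # y → x ≈ y
    #-tight h = mk≈ (R.#-tight (λ k → h (mk# (inj₁ k)))) (R.#-tight (λ k → h (mk# (inj₂ k))))

    #⇒invertible : ∀ {x y} → x # y → Invertible _≈_ 1ℂ _*_ (x - y)
    #⇒invertible {x} {y} (mk# h) =
      let a = re (x - y)
          b = im (x - y)
          (t , ∣z∣²t≈1) = R.reciprocal (R.#0⇒sumOfSquares#0 a b (Sum.map R.#⇒-#0 R.#⇒-#0 h))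
          w = (a R.* t) +i (R.- (b R.* t))
          zw≈1 = mk≈ (≈ᴿ.trans (R.re-conjugate a b t) ∣z∣²t≈1) (R.im-conjugate a b t)
      in w , ≈-trans (*-comm w (x - y)) zw≈1 , zw≈1

    invertible⇒# : ∀ {x y} → Invertible _≈_ 1ℂ _*_ (x - y) → x # y
    invertible⇒# (w , _ , mk≈ re≈1 _) = mk# (Sum.map
      (λ h → R.-#0⇒# (R.*#0⇒#0 h))
      (λ h → R.-#0⇒# (R.*#0⇒#0 (R.#-sym h)))
      (R.#-cotrans (R.-#0⇒# (R.#-respˡ-≈ (≈ᴿ.sym re≈1) R.1#0)) 0ℝ))

    isHeytingField : IsHeytingField _≈_ _#_ _+_ _*_ -_ 0ℂ 1ℂ
    isHeytingField = record
      { isHeytingCommutativeRing = record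
        { isCommutativeRing = record
          { isRing = record
            { +-isAbelianGroup = record
              { isGroup = record
                { isMonoid = record
                  { isSemigroup = record
                    { isMagma = record { isEquivalence = ≈-isEquivalence ; ∙-cong = +-cong }
                    ; assoc   = +-assoc
                    }
                  ; identity = +-identityˡ , λ x → ≈-trans (+-comm x 0ℂ) (+-identityˡ x)
                  }
                ; inverse = -‿inverseˡ , λ x → ≈-trans (+-comm x (- x)) (-‿inverseˡ x)
                ; ⁻¹-cong = -‿cong
                }
              ; comm = +-comm
              }
            ; *-cong     = *-cong
            ; *-assoc    = *-assoc
            ; *-identity = *-identityˡ , λ x → ≈-trans (*-comm x 1ℂ) (*-identityˡ x)
            ; distrib    = *-distribˡ-+ , *-distribʳ-+
            }
          ; *-comm = *-comm
          }
        ; isApartnessRelation = record { irrefl = #-irrefl ; sym = #-sym ; cotrans = #-cotrans }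
        ; #⇒invertible = #⇒invertible
        ; invertible⇒# = invertible⇒#
        }
      ; tight = λ x y → #-tight , #-irrefl
      }

  ℂ-heytingField : HeytingField 0ℓ 0ℓ 0ℓ
  ℂ-heytingField = record { isHeytingField = isHeytingField }

module FieldNotation {c ℓ₁ ℓ₂} (K : HeytingField c ℓ₁ ℓ₂) where

  open HeytingField K public
  open HeytingCommutativeRing heytingCommutativeRing public using (commutativeRing)
  open CommutativeRing commutativeRing public using (semiring; +-commutativeMonoid)
  open import Algebra.Properties.Semiring.Exp semiring public using (_^_)
  open import Algebra.Properties.CommutativeMonoid.Sum +-commutativeMonoid public using (sum; sum-syntax)
  open import Algebra.Properties.Semiring.Mult semiring using (_×_)
  open import Algebra.Apartness.Properties.HeytingCommutativeRing heytingCommutativeRing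
    using (x-0≈x; invertibleʳ⇒#)
  open import Data.Product.Base using (_,_; proj₁)
  open import Relation.Binary.Reasoning.Setoid setoid

  ι : ℕ → Carrier
  ι n = n × 1#

  reciprocal : (a : Carrier) → a # 0# → Carrier
  reciprocal a a#0 = proj₁ (#⇒invertible a#0)

  infixr 8 _^[_]_

  -- Integer powers of an invertible element.
  _^[_]_ : (a : Carrier) → a # 0# → ℤ → Carrier
  a ^[ a#0 ] (ℤ.+ m)    = a ^ m
  a ^[ a#0 ] ℤ.-[1+ m ] = reciprocal a a#0 ^ suc m

  -- The polynomials Tₙ, Uₙ and Fₙ are given by their values at a point.

  T : ℕ → Carrier → Carrier
  T zero          x = 1#
  T (suc zero)    x = x
  T (suc (suc n)) x = ι 2 * x * T (suc n) x - T n x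

  U : ℕ → Carrier → Carrier
  U zero          x = 1#
  U (suc zero)    x = ι 2 * x
  U (suc (suc n)) x = ι 2 * x * U (suc n) x - U n x

  F : ℕ → Carrier → Carrier
  F zero          x = 0#
  F (suc zero)    x = 1#
  F (suc (suc n)) x = x * F (suc n) x + F n x

  -- The second argument is the chosen square root of x² - 1.
  α β : Carrier → Carrier → Carrier
  α x r = x + r
  β x r = x - r

  sqrt#0 : ∀ {x r} → r * r ≈ x * x - 1# → x * x # 1# → r # 0#
  sqrt#0 {x} {r} r²≈x²-1 x²#1 =
    let (c , _ , [x²-1]c≈1) = #⇒invertible x²#1 in
    invertibleʳ⇒# (r * c , (begin
      (r - 0#) * (r * c)   ≈⟨ *-congʳ (x-0≈x r) ⟩
      r * (r * c)          ≈⟨ *-assoc r r c ⟨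
      r * r * c            ≈⟨ *-congʳ r²≈x²-1 ⟩
      (x * x - 1#) * c     ≈⟨ [x²-1]c≈1 ⟩
      1#                   ∎))

open ComplexNumbers public using (ℂ; ℂ-heytingField)
open FieldNotation ℂ-heytingField public

{-# OPTIONS --safe #-}

-- Write ∂ for the shift of sequences.  The binomial convolution is the product of exponential
-- generating functions, so ∂ acts on it by the Leibniz rule.  Let s² = x² + 4 and r² = x² - 1.
-- On the left, ∂² = s² on the first factor and (∂ - x)² = r² on the second (Tₖ or Uₖ); on the
-- right, ∂² = r² on the first factor and (∂ - x)² = s² on the second (2ᵏ⁻¹Fₖ).  Hence both
-- convolutions satisfy the same linear recurrence, and it remains to compare initial values.
-- In this form no division by s is needed, and s = 0 is not a special case.

module Submission where

open import Defs using (module FieldNotation)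
open import Algebra.Apartness.Bundles using (HeytingField)
open import Algebra.Bundles using (CommutativeRing; CommutativeSemiring)
open import Data.Fin using (toℕ; inject₁; fromℕ)
open import Data.Fin.Properties using (toℕ-inject₁; toℕ-fromℕ; toℕ<n)
open import Data.Integer as ℤ using (+_)
import Data.Integer.Properties as ℤ
open import Data.Nat using (ℕ; suc; zero; _∸_; _≤_; _<_)
open import Data.Nat.Combinatorics using (_C_; nCk+nC[k+1]≡[n+1]C[k+1])
open import Data.Nat.Combinatorics.Specification using (k>n⇒nCk≡0)
import Data.Nat.Properties as ℕ
open import Data.Product using (_×_; _,_; proj₁; proj₂)
open import Relation.Binary.PropositionalEquality as ≡ using (_≡_)

-- Binomial convolution and its Leibniz rule.

module BinomialConvolution {c ℓ} (S : CommutativeSemiring c ℓ) where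

  open CommutativeSemiring S
  open import Algebra.Properties.Semiring.Mult semiring using (×-homo-+) renaming (_×_ to _·_)
  open import Algebra.Properties.Semiring.Sum semiring
  open import Algebra.Solver.Ring.NaturalCoefficients.Default S
    using (solve; _:=_; _:+_; _:*_; con)
  open import Relation.Binary.Reasoning.Setoid setoid

  Sequence : Set c
  Sequence = ℕ → Carrier

  ∂ : Sequence → Sequence
  ∂ f k = f (suc k)

  ∑< : ℕ → Sequence → Carrier
  ∑< n t = ∑[ i < n ] t (toℕ i)

  ∑<-cong : ∀ n t u → (∀ k → k < n → t k ≈ u k) → ∑< n t ≈ ∑< n u
  ∑<-cong n t u p = sum-cong-≋ {n} {λ i → t (toℕ i)} {λ i → u (toℕ i)} λ i → p (toℕ i) (toℕ<n i)

  ∑<-+ : ∀ n t u → ∑< n (λ k → t k + u k) ≈ ∑< n t + ∑< n u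
  ∑<-+ n t u = ∑-distrib-+ {n} (λ i → t (toℕ i)) (λ i → u (toℕ i))

  ∑<-* : ∀ n a t → ∑< n (λ k → a * t k) ≈ a * ∑< n t
  ∑<-* n a t = sym (*-distribˡ-sum {n} a (λ i → t (toℕ i)))

  ∑<-drop-last : ∀ n t → t n ≈ 0# → ∑< (suc n) t ≈ ∑< n t
  ∑<-drop-last n t tn≈0 = begin
    ∑< (suc n) t
      ≈⟨ sum-init-last {n} (λ i → t (toℕ i)) ⟩
    ∑[ i < n ] t (toℕ (inject₁ i)) + t (toℕ (fromℕ n))
      ≈⟨ +-cong (reflexive (sum-cong-≗ {n} (λ i → ≡.cong t (toℕ-inject₁ i))))
                (trans (reflexive (≡.cong t (toℕ-fromℕ n))) tn≈0) ⟩
    ∑< n t + 0#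
      ≈⟨ +-identityʳ _ ⟩
    ∑< n t ∎

  -- The coefficient is a multiple of `1#`, so that over a field it unfolds to `ι (n C k)`.
  term : Sequence → Sequence → ℕ → Sequence
  term f g n k = (n C k) · 1# * f (n ∸ k) * g k

  conv : Sequence → Sequence → Sequence
  conv f g n = ∑< (suc n) (term f g n)

  conv-cong : ∀ {f f′ g g′} → (∀ k → f k ≈ f′ k) → (∀ k → g k ≈ g′ k) →
              ∀ n → conv f g n ≈ conv f′ g′ n
  conv-cong {f} {f′} {g} {g′} p q n = ∑<-cong (suc n) (term f g n) (term f′ g′ n)
    λ k _ → *-cong (*-congˡ (p (n ∸ k))) (q k)

  conv-+ʳ : ∀ f g h n → conv f (λ k → g k + h k) n ≈ conv f g n + conv f h n
  conv-+ʳ f g h n = trans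
    (∑<-cong (suc n) _ (λ k → term f g n k + term f h n k)
      (λ k _ → distribˡ ((n C k) · 1# * f (n ∸ k)) (g k) (h k)))
    (∑<-+ (suc n) (term f g n) (term f h n))

  conv-*ˡ : ∀ a f g n → conv (λ k → a * f k) g n ≈ a * conv f g n
  conv-*ˡ a f g n = trans
    (∑<-cong (suc n) _ (λ k → a * term f g n k) λ k _ →
      solve 4 (λ a b u v → b :* (a :* u) :* v := a :* (b :* u :* v)) refl
        a ((n C k) · 1#) (f (n ∸ k)) (g k))
    (∑<-* (suc n) a (term f g n))

  conv-*ʳ : ∀ a f g n → conv f (λ k → a * g k) n ≈ a * conv f g n
  conv-*ʳ a f g n = trans
    (∑<-cong (suc n) _ (λ k → a * term f g n k) λ k _ →
      solve 4 (λ a b u v → b :* u :* (a :* v) := a :* (b :* u :* v)) refl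
        a ((n C k) · 1#) (f (n ∸ k)) (g k))
    (∑<-* (suc n) a (term f g n))

  conv-zero : ∀ f g → conv f g 0 ≈ f 0 * g 0
  conv-zero f g = solve 2 (λ u v → (con 1 :+ con 0) :* u :* v :+ con 0 := u :* v) refl (f 0) (g 0)

  -- Pascal's rule splits each term with positive index in two. One half sums to `conv f (∂ g) n`;
  -- the other, joined with the term at index 0, sums to `conv (∂ f) g n`.
  conv-leibniz : ∀ f g n → conv f g (suc n) ≈ conv (∂ f) g n + conv f (∂ g) n
  conv-leibniz f g n = begin
    first + ∑< (suc n) (∂ (term f g (suc n)))
      ≈⟨ +-congˡ (trans (∑<-cong (suc n) (∂ (term f g (suc n))) _ (λ k _ → pascal k))
                        (∑<-+ (suc n) (term f (∂ g) n) rest)) ⟩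
    first + (conv f (∂ g) n + ∑< (suc n) rest)
      -- Index `n` has to go before the reindexing below, since `n ∸ k` equals `suc (n ∸ suc k)`
      -- only for `k < n`. Its coefficient `n C suc n` is zero.
      ≈⟨ +-congˡ (+-congˡ (∑<-drop-last n rest (vanish (n C suc n) (k>n⇒nCk≡0 (ℕ.n<1+n n))))) ⟩
    first + (conv f (∂ g) n + ∑< n rest)
      ≈⟨ solve 3 (λ a b c → a :+ (b :+ c) := (a :+ c) :+ b) refl first (conv f (∂ g) n) (∑< n rest) ⟩
    (first + ∑< n rest) + conv f (∂ g) n
      ≈⟨ +-congʳ (+-congˡ (∑<-cong n rest (∂ (term (∂ f) g n)) λ k k<n →
           *-congʳ (*-congˡ (reflexive (≡.cong f (ℕ.+-∸-assoc 1 k<n)))))) ⟩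
    conv (∂ f) g n + conv f (∂ g) n ∎
    where
    first : Carrier
    first = term f g (suc n) 0
    rest : Sequence
    rest k = (n C suc k) · 1# * f (n ∸ k) * g (suc k)
    vanish : ∀ b → b ≡ 0 → b · 1# * f (n ∸ n) * g (suc n) ≈ 0#
    vanish _ ≡.refl = solve 2 (λ u v → con 0 :* u :* v := con 0) refl (f (n ∸ n)) (g (suc n))
    pascal : ∀ k → term f g (suc n) (suc k) ≈ term f (∂ g) n k + rest k
    pascal k = begin
      (suc n C suc k) · 1# * f (n ∸ k) * g (suc k)
        ≈⟨ *-congʳ (*-congʳ (trans
             (reflexive (≡.cong (_· 1#) (≡.sym (nCk+nC[k+1]≡[n+1]C[k+1] n k))))
             (×-homo-+ 1# (n C k) (n C suc k)))) ⟩
      ((n C k) · 1# + (n C suc k) · 1#) * f (n ∸ k) * g (suc k)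
        ≈⟨ solve 4 (λ a b u v → (a :+ b) :* u :* v := a :* u :* v :+ b :* u :* v) refl
             ((n C k) · 1#) ((n C suc k) · 1#) (f (n ∸ k)) (g (suc k)) ⟩
      term f (∂ g) n k + rest k ∎

  -- Both equations say (∂ - x)² g = σ g, where h = (∂ - x) g.
  record Jet (x σ : Carrier) (g h : Sequence) : Set ℓ where
    field
      ∂g : ∀ k → g (suc k) ≈ x * g k + h k
      ∂h : ∀ k → h (suc k) ≈ x * h k + σ * g k

  -- First-order recurrences for convolutions, and uniqueness.

  module _ {x σ ρ : Carrier} {f g h : Sequence}
           (∂²f : ∀ k → f (suc (suc k)) ≈ σ * f k) (jet : Jet x ρ g h) where

    open Jet jet

    private
      -- The scalar `y` is `1#` for the equation `∂g` and `ρ` for `∂h`; `∂g′` puts the former into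
      -- this shape.
      conv-jet : ∀ e {g h} y → (∀ k → g (suc k) ≈ x * g k + y * h k) → ∀ n →
                 conv e (∂ g) n ≈ x * conv e g n + y * conv e h n
      conv-jet e {g} {h} y p n = trans
        (conv-cong {e} {e} (λ _ → refl) p n)
        (trans (conv-+ʳ e (λ k → x * g k) (λ k → y * h k) n)
               (+-cong (conv-*ʳ x e g n) (conv-*ʳ y e h n)))

      ∂g′ : ∀ k → g (suc k) ≈ x * g k + 1# * h k
      ∂g′ k = trans (∂g k) (+-congˡ (sym (*-identityˡ (h k))))

      conv-∂² : ∀ e n → conv (∂ (∂ f)) e n ≈ σ * conv f e n
      conv-∂² e n = trans (conv-cong {g = e} ∂²f (λ _ → refl) n) (conv-*ˡ σ f e n)

    -- Since `∂ (∂ f)` is `σ * f` and `∂` preserves the span of `g` and `h`, the four convolutions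
    -- of `f`, `∂ f` with `g`, `h` form a closed first-order linear system. In the names, the first
    -- digit counts `∂` on `f`, the second `∂ - x` on `g`.
    conv-step₀₀ : ∀ n → conv f g (suc n) ≈ conv (∂ f) g n + (x * conv f g n + 1# * conv f h n)
    conv-step₀₀ n = trans (conv-leibniz f g n) (+-congˡ (conv-jet f 1# ∂g′ n))

    conv-step₁₀ : ∀ n → conv (∂ f) g (suc n)
                      ≈ σ * conv f g n + (x * conv (∂ f) g n + 1# * conv (∂ f) h n)
    conv-step₁₀ n = trans (conv-leibniz (∂ f) g n) (+-cong (conv-∂² g n) (conv-jet (∂ f) 1# ∂g′ n))

    conv-step₀₁ : ∀ n → conv f h (suc n) ≈ conv (∂ f) h n + (x * conv f h n + ρ * conv f g n)
    conv-step₀₁ n = trans (conv-leibniz f h n) (+-congˡ (conv-jet f ρ ∂h n))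

    conv-step₁₁ : ∀ n → conv (∂ f) h (suc n)
                      ≈ σ * conv f h n + (x * conv (∂ f) h n + ρ * conv (∂ f) g n)
    conv-step₁₁ n = trans (conv-leibniz (∂ f) h n) (+-cong (conv-∂² h n) (conv-jet (∂ f) ρ ∂h n))

  -- A bar means `∂`, a tilde `∂ - x`. The pairing is crossed: `∂` on `a` goes with `∂ - x` on `d`,
  -- as both square to `σ` in `conv-unique`, and `∂ - x` on `b` with `∂` on `c`, as both square to
  -- `ρ`.
  record InitialValues (a b b̃ c d d̃ : Sequence) : Set ℓ where
    field
      ab : a 0 * b 0 ≈ c 0 * d 0
      āb : a 1 * b 0 ≈ c 0 * d̃ 0
      ab̃ : a 0 * b̃ 0 ≈ c 1 * d 0
      āb̃ : a 1 * b̃ 0 ≈ c 1 * d̃ 0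

  -- The recurrences couple the four convolutions, so the induction carries four equations at once.
  conv-unique : ∀ {x σ ρ a b b̃ c d d̃} →
    (∀ k → a (suc (suc k)) ≈ σ * a k) → Jet x ρ b b̃ →
    (∀ k → c (suc (suc k)) ≈ ρ * c k) → Jet x σ d d̃ →
    InitialValues a b b̃ c d d̃ → ∀ n → conv a b n ≈ conv c d n
  conv-unique {x} {σ} {ρ} {a} {b} {b̃} {c} {d} {d̃} ∂²a jet-b ∂²c jet-d init n = proj₁ (all n)
    where
    open InitialValues init
    at-zero : ∀ f g f′ g′ → f 0 * g 0 ≈ f′ 0 * g′ 0 → conv f g 0 ≈ conv f′ g′ 0
    at-zero f g f′ g′ p = trans (conv-zero f g) (trans p (sym (conv-zero f′ g′)))
    all : ∀ n → conv a b n ≈ conv c d n × conv (∂ a) b n ≈ conv c d̃ n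
              × conv a b̃ n ≈ conv (∂ c) d n × conv (∂ a) b̃ n ≈ conv (∂ c) d̃ n
    all zero = at-zero a b c d ab , at-zero (∂ a) b c d̃ āb
             , at-zero a b̃ (∂ c) d ab̃ , at-zero (∂ a) b̃ (∂ c) d̃ āb̃
    all (suc n) with all n
    ... | p₀₀ , p₁₀ , p₀₁ , p₁₁ =
        step (conv-step₀₀ ∂²a jet-b n) (conv-step₀₀ ∂²c jet-d n)
          (trans (+-cong p₁₀ (+-cong (*-congˡ p₀₀) (*-congˡ p₀₁)))
                 (solve 3 (λ u v w → u :+ (v :+ con 1 :* w) := w :+ (v :+ con 1 :* u)) refl _ _ _))
      -- Because the pairing is crossed, step 10 on the left meets step 01 on the right, and
      -- conversely below.
      , step (conv-step₁₀ ∂²a jet-b n) (conv-step₀₁ ∂²c jet-d n)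
          (trans (+-cong (*-congˡ p₀₀) (+-cong (*-congˡ p₁₀) (*-congˡ p₁₁)))
                 (solve 3 (λ u v w → u :+ (v :+ con 1 :* w) := w :+ (v :+ u)) refl _ _ _))
      , step (conv-step₀₁ ∂²a jet-b n) (conv-step₁₀ ∂²c jet-d n)
          (trans (+-cong p₁₁ (+-cong (*-congˡ p₀₁) (*-congˡ p₀₀)))
                 (solve 3 (λ u v w → u :+ (v :+ w) := w :+ (v :+ con 1 :* u)) refl _ _ _))
      , step (conv-step₁₁ ∂²a jet-b n) (conv-step₁₁ ∂²c jet-d n)
          (trans (+-cong (*-congˡ p₀₁) (+-cong (*-congˡ p₁₁) (*-congˡ p₁₀)))
                 (solve 3 (λ u v w → u :+ (v :+ w) := w :+ (v :+ u)) refl _ _ _))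
      where
      step : ∀ {u v u′ v′} → u ≈ u′ → v ≈ v′ → u′ ≈ v′ → u ≈ v
      step p q r = trans p (trans r (sym q))

-- A convolution weight may depend on `n ∸ k` only; this brings the integer exponent of the second
-- identity into that form.
n-1-k≡[n∸k]-1 : ∀ {n k} → k ≤ n → + n ℤ.- + 1 ℤ.- + k ≡ + (n ∸ k) ℤ.- + 1
n-1-k≡[n∸k]-1 {n} {k} k≤n = ≡.trans (ℤ.+-assoc (+ n) (ℤ.- + 1) (ℤ.- + k))
  (≡.trans (≡.cong (λ z → + n ℤ.+ z) (ℤ.+-comm (ℤ.- + 1) (ℤ.- + k)))
  (≡.trans (≡.sym (ℤ.+-assoc (+ n) (ℤ.- + k) (ℤ.- + 1)))
           (≡.cong (ℤ._- + 1) (≡.trans (ℤ.m-n≡m⊖n n k) (ℤ.⊖-≥ k≤n)))))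

-- The weights built from powers of the two roots, and their recurrences.

module ChebyshevFibonacci {c ℓ₁ ℓ₂} (K : HeytingField c ℓ₁ ℓ₂) where

  open FieldNotation K
  open CommutativeRing commutativeRing using (commutativeSemiring; ring; +-group)
  open BinomialConvolution commutativeSemiring
  open import Algebra.Properties.Group +-group using () renaming (∙-cancelʳ to +-cancelʳ)
  open import Algebra.Properties.Ring ring using (-1*x≈-x; -‿involutive)
  open import Algebra.Solver.Ring.NaturalCoefficients.Default commutativeSemiring
    using (solve; _:=_; _:+_; _:*_; con)
  open import Relation.Binary.Reasoning.Setoid setoid

  -1# : Carrier
  -1# = - 1#

  -- The truncated exponents 0 ∸ 1 are harmless: oddPart s 0 and scaledF x 0 vanish anyway.
  oddPart evenPart : Carrier → Sequence
  oddPart  s j = s ^ (j ∸ 1) * (1# - -1# ^ j)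
  evenPart r j = r ^ j * (1# + -1# ^ j)

  scaledF : Carrier → Sequence
  scaledF x k = ι 2 ^ (k ∸ 1) * F k x

  -- Unlike in `oddPart`, the exponent -1 at `j = 0` matters: the bracket there is `α - β = 2r`, and
  -- the reciprocal turns it into 2.
  mixedPart : (x r : Carrier) → r # 0# → Sequence
  mixedPart x r r#0 j = r ^[ r#0 ] (+ j ℤ.- + 1) * (α x r - -1# ^ j * β x r)

  private

    -1*-1≈1 : -1# * -1# ≈ 1#
    -1*-1≈1 = trans (-1*x≈-x -1#) (-‿involutive 1#)

    -1^[2+j] : ∀ j → -1# ^ suc (suc j) ≈ -1# ^ j
    -1^[2+j] j = trans (sym (*-assoc -1# -1# (-1# ^ j)))
                       (trans (*-congʳ -1*-1≈1) (*-identityˡ (-1# ^ j)))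

    y+[x-y]≈x : ∀ x y → y + (x - y) ≈ x
    y+[x-y]≈x x y = begin
      y + (x - y)    ≈⟨ solve 3 (λ x y z → y :+ (x :+ z) := x :+ (y :+ z)) refl x y (- y) ⟩
      x + (y - y)    ≈⟨ +-congˡ (-‿inverseʳ y) ⟩
      x + 0#         ≈⟨ +-identityʳ x ⟩
      x              ∎

  ∂²-oddPart : ∀ s j → oddPart s (suc (suc j)) ≈ s * s * oddPart s j
  -- Truncation breaks the pattern of powers here, `s` standing against `s * s`, but the parity
  -- factors on both sides vanish.
  ∂²-oddPart s zero = begin
    s * 1# * (1# - -1# ^ 2)
      ≈⟨ *-congˡ (trans (+-congˡ (-‿cong (-1^[2+j] 0))) (-‿inverseʳ 1#)) ⟩
    s * 1# * 0#
      ≈⟨ solve 1 (λ s → s :* con 1 :* con 0 := s :* s :* (con 1 :* con 0)) refl s ⟩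
    s * s * (1# * 0#)
      ≈⟨ *-congˡ (*-congˡ (-‿inverseʳ 1#)) ⟨
    s * s * (1# * (1# - 1#)) ∎
  ∂²-oddPart s (suc j) = trans
    (*-congˡ (+-congˡ (-‿cong (-1^[2+j] (suc j)))))
    (solve 3 (λ s p q → s :* (s :* p) :* q := s :* s :* (p :* q)) refl s (s ^ j) (1# - -1# ^ suc j))

  ∂²-evenPart : ∀ r j → evenPart r (suc (suc j)) ≈ r * r * evenPart r j
  ∂²-evenPart r j = trans
    (*-congˡ (+-congˡ (-1^[2+j] j)))
    (solve 3 (λ s p q → s :* (s :* p) :* q := s :* s :* (p :* q)) refl r (r ^ j) (1# + -1# ^ j))

  r*r⁻¹≈1 : ∀ r (r#0 : r # 0#) → r * reciprocal r r#0 ≈ 1#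
  -- `#⇒invertible` supplies an inverse of `r - 0#`, whence `x-0≈x`.
  r*r⁻¹≈1 r r#0 = trans (*-congʳ (sym (x-0≈x r))) (proj₂ (proj₂ (#⇒invertible r#0)))
    where open import Algebra.Apartness.Properties.HeytingCommutativeRing heytingCommutativeRing
            using (x-0≈x)

  ∂²-mixedPart : ∀ x r r#0 j → mixedPart x r r#0 (suc (suc j)) ≈ r * r * mixedPart x r r#0 j
  -- The only index with a negative power: `1#` is expanded to `r` times its reciprocal.
  ∂²-mixedPart x r r#0 zero = begin
    r * 1# * (α x r - -1# ^ 2 * β x r)
      ≈⟨ *-congˡ (+-congˡ (-‿cong (*-congʳ (-1^[2+j] 0)))) ⟩
    r * 1# * z
      ≈⟨ *-congʳ (*-congˡ (r*r⁻¹≈1 r r#0)) ⟨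
    r * (r * reciprocal r r#0) * z
      ≈⟨ solve 3 (λ r t z → r :* (r :* t) :* z := r :* r :* (t :* con 1 :* z)) refl
           r (reciprocal r r#0) z ⟩
    r * r * (reciprocal r r#0 * 1# * z) ∎
    where
    z : Carrier
    z = α x r - 1# * β x r
  ∂²-mixedPart x r r#0 (suc j) = trans
    (*-congˡ (+-congˡ (-‿cong (*-congʳ (-1^[2+j] (suc j))))))
    (solve 3 (λ s p q → s :* (s :* p) :* q := s :* s :* (p :* q)) refl r (r ^ j) (α x r - -1# ^ suc j * β x r))

  -- Jets of the Chebyshev and scaled Fibonacci sequences.

  [∂-_] : Carrier → Sequence → Sequence
  [∂- x ] g k = g (suc k) - x * g k

  -- The hypothesis is `(∂ - x)² g = σ g` expanded, with the negative term moved across to suit a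
  -- solver for semirings.
  jet : ∀ {x σ g} → (∀ k → g (suc (suc k)) + x * x * g k ≈ ι 2 * x * g (suc k) + σ * g k) →
        Jet x σ g ([∂- x ] g)
  jet {x} {σ} {g} rec = record
    { ∂g = λ k → sym (y+[x-y]≈x (g (suc k)) (x * g k))
    -- The added summand clears the subtractions on both sides, leaving the two sides of the
    -- hypothesis.
    ; ∂h = λ k → +-cancelʳ (x * g (suc k) + x * (x * g k)) _ _ (trans (left k) (sym (right k)))
    }
    where
    left : ∀ k → (g (suc (suc k)) - x * g (suc k)) + (x * g (suc k) + x * (x * g k))
               ≈ ι 2 * x * g (suc k) + σ * g k
    left k = begin
      (g (suc (suc k)) - x * g (suc k)) + (x * g (suc k) + x * (x * g k))
        ≈⟨ solve 5 (λ p q u x g → (p :+ q) :+ (u :+ x :* (x :* g)) := (u :+ (p :+ q)) :+ x :* x :* g)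
             refl (g (suc (suc k))) (- (x * g (suc k))) (x * g (suc k)) x (g k) ⟩
      (x * g (suc k) + (g (suc (suc k)) - x * g (suc k))) + x * x * g k
        ≈⟨ +-congʳ (y+[x-y]≈x (g (suc (suc k))) (x * g (suc k))) ⟩
      g (suc (suc k)) + x * x * g k
        ≈⟨ rec k ⟩
      ι 2 * x * g (suc k) + σ * g k ∎
    right : ∀ k → (x * (g (suc k) - x * g k) + σ * g k) + (x * g (suc k) + x * (x * g k))
                ≈ ι 2 * x * g (suc k) + σ * g k
    right k = begin
      (x * (g (suc k) - x * g k) + σ * g k) + (x * g (suc k) + x * (x * g k))
        ≈⟨ solve 5 (λ x d t u v → (x :* d :+ t) :+ (x :* u :+ x :* v)
                               := x :* (v :+ d) :+ x :* u :+ t)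
             refl x (g (suc k) - x * g k) (σ * g k) (g (suc k)) (x * g k) ⟩
      x * (x * g k + (g (suc k) - x * g k)) + x * g (suc k) + σ * g k
        ≈⟨ +-congʳ (+-congʳ (*-congˡ (y+[x-y]≈x (g (suc k)) (x * g k)))) ⟩
      x * g (suc k) + x * g (suc k) + σ * g k
        ≈⟨ solve 3 (λ x u t → x :* u :+ x :* u :+ t
                            := (con 1 :+ (con 1 :+ con 0)) :* x :* u :+ t)
             refl x (g (suc k)) (σ * g k) ⟩
      ι 2 * x * g (suc k) + σ * g k ∎

  -- Completing the square: `t² - 2xt + 1 = (t - x)² - (x² - 1)`. `T` and `U` share this recurrence.
  chebyshev-jet : ∀ {x r g} → r * r ≈ x * x - 1# →
                  (∀ k → g (suc (suc k)) ≈ ι 2 * x * g (suc k) - g k) →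
                  Jet x (r * r) g ([∂- x ] g)
  chebyshev-jet {x} {r} {g} r²≈x²-1 rec = jet λ k → begin
    g (suc (suc k)) + x * x * g k
      ≈⟨ +-congʳ (rec k) ⟩
    (ι 2 * x * g (suc k) - g k) + x * x * g k
      -- As a multiple of the atom `-1#`, the negated term becomes accessible to the solver.
      ≈⟨ +-congʳ (+-congˡ (-1*x≈-x (g k))) ⟨
    (ι 2 * x * g (suc k) + -1# * g k) + x * x * g k
      ≈⟨ solve 4 (λ p m x g → (p :+ m :* g) :+ x :* x :* g := p :+ (x :* x :+ m) :* g)
           refl (ι 2 * x * g (suc k)) -1# x (g k) ⟩
    ι 2 * x * g (suc k) + (x * x - 1#) * g k
      ≈⟨ +-congˡ (*-congʳ r²≈x²-1) ⟨
    ι 2 * x * g (suc k) + r * r * g k ∎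

  -- The powers of 2 turn `t² - xt - 1` into `t² - 2xt - 4 = (t - x)² - (x² + 4)`, with the same
  -- centre `x` as for Chebyshev.
  scaledF-jet : ∀ {x s} → s * s ≈ x * x + ι 4 → Jet x (s * s) (scaledF x) ([∂- x ] (scaledF x))
  scaledF-jet {x} {s} s²≈x²+4 = jet λ k → trans (rec k) (+-congˡ (*-congʳ (sym s²≈x²+4)))
    where
    rec : ∀ k → scaledF x (suc (suc k)) + x * x * scaledF x k
              ≈ ι 2 * x * scaledF x (suc k) + (x * x + ι 4) * scaledF x k
    -- Here `0 ∸ 1` breaks the doubling of the powers of 2, but `F 0 x` is zero. `two` spells out
    -- `ι 2` in unfolded form.
    rec zero = solve 1
      (λ x → let two = con 1 :+ (con 1 :+ con 0) in
        two :* con 1 :* (x :* con 1 :+ con 0) :+ x :* x :* (con 1 :* con 0)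
        := two :* x :* (con 1 :* con 1) :+ (x :* x :+ (con 1 :+ (con 1 :+ two))) :* (con 1 :* con 0))
      refl x
    rec (suc k) = solve 4
      (λ x p u v → let two = con 1 :+ (con 1 :+ con 0) in
        two :* (two :* p) :* (x :* v :+ u) :+ x :* x :* (p :* u)
        := two :* x :* (two :* p :* v) :+ (x :* x :+ (con 1 :+ (con 1 :+ two))) :* (p :* u))
      refl x (ι 2 ^ k) (F (suc k) x) (F (suc (suc k)) x)

  -- Initial values and the two convolution identities.

  oddPart-zero : ∀ s → oddPart s 0 ≈ 0#
  oddPart-zero s = trans (*-identityˡ _) (-‿inverseʳ 1#)

  oddPart-one : ∀ s → oddPart s 1 ≈ 1# + 1#
  oddPart-one s = trans (*-identityˡ _)
    (+-congˡ (trans (-‿cong (*-identityʳ -1#)) (-‿involutive 1#)))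

  scaledF-zero : ∀ x → scaledF x 0 ≈ 0#
  scaledF-zero x = zeroʳ 1#

  -- Two of the four equations read `0 = 0`, as `oddPart s` and `scaledF x` vanish at 0. The others
  -- follow from the hypotheses, since `oddPart s 1` is 2 and `[∂- x ] (scaledF x) 0` is 1.
  initialValues : ∀ {x s b c} → b 0 ≈ 1# → c 0 ≈ 1# + 1# →
    c 1 ≈ (1# + 1#) * [∂- x ] b 0 →
    InitialValues (oddPart s) b ([∂- x ] b) c (scaledF x) ([∂- x ] (scaledF x))
  initialValues {x} {s} {b} {c} b0≈1 c0≈2 c1≈ = record
    { ab = both-zero (b 0) (c 0)
    ; āb = trans (*-cong (trans (oddPart-one s) (sym c0≈2)) b0≈1) (*-congˡ (sym d̃0≈1))
    ; ab̃ = both-zero ([∂- x ] b 0) (c 1)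
    ; āb̃ = begin
        oddPart s 1 * [∂- x ] b 0    ≈⟨ *-congʳ (oddPart-one s) ⟩
        (1# + 1#) * [∂- x ] b 0      ≈⟨ c1≈ ⟨
        c 1                          ≈⟨ *-identityʳ (c 1) ⟨
        c 1 * 1#                     ≈⟨ *-congˡ d̃0≈1 ⟨
        c 1 * [∂- x ] (scaledF x) 0  ∎
    }
    where
    both-zero : ∀ y z → oddPart s 0 * y ≈ z * scaledF x 0
    both-zero y z = begin
      oddPart s 0 * y    ≈⟨ *-congʳ (oddPart-zero s) ⟩
      0# * y             ≈⟨ solve 2 (λ y z → con 0 :* y := z :* con 0) refl y z ⟩
      z * 0#             ≈⟨ *-congˡ (scaledF-zero x) ⟨
      z * scaledF x 0    ∎
    d̃0≈1 : [∂- x ] (scaledF x) 0 ≈ 1#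
    d̃0≈1 = begin
      1# * 1# - x * (1# * 0#)
        ≈⟨ +-congʳ (solve 1 (λ x → con 1 :* con 1 := x :* (con 1 :* con 0) :+ con 1) refl x) ⟩
      x * (1# * 0#) + 1# - x * (1# * 0#)     ≈⟨ +-assoc _ _ _ ⟩
      x * (1# * 0#) + (1# - x * (1# * 0#))   ≈⟨ y+[x-y]≈x 1# _ ⟩
      1#                                     ∎

  conv-T : ∀ {x r s} → r * r ≈ x * x - 1# → s * s ≈ x * x + ι 4 → ∀ n →
           conv (oddPart s) (λ k → T k x) n ≈ conv (evenPart r) (scaledF x) n
  conv-T {x} {r} {s} root₁ root₂ = conv-unique {b = λ k → T k x}
    (∂²-oddPart s) (chebyshev-jet {g = λ k → T k x} root₁ (λ _ → refl))
    (∂²-evenPart r) (scaledF-jet root₂)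
    (initialValues {b = λ k → T k x} refl (*-identityˡ (1# + 1#)) (begin
      -- Both sides vanish: the left by parity, the right because `T 1 x` equals `x * T 0 x`.
      r * 1# * (1# + -1# * 1#)  ≈⟨ *-congˡ (trans (+-congˡ (*-identityʳ -1#)) (-‿inverseʳ 1#)) ⟩
      r * 1# * 0#               ≈⟨ zeroʳ _ ⟩
      0#                        ≈⟨ zeroʳ _ ⟨
      (1# + 1#) * 0#            ≈⟨ *-congˡ (trans (+-congˡ (-‿cong (*-identityʳ x))) (-‿inverseʳ x)) ⟨
      (1# + 1#) * (x - x * 1#)  ∎))

  conv-U : ∀ {x r s} → r * r ≈ x * x - 1# → (r#0 : r # 0#) → s * s ≈ x * x + ι 4 → ∀ n →
           conv (oddPart s) (λ k → U k x) n ≈ conv (mixedPart x r r#0) (scaledF x) n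
  conv-U {x} {r} {s} root₁ r#0 root₂ = conv-unique {b = λ k → U k x}
    (∂²-oddPart s) (chebyshev-jet {g = λ k → U k x} root₁ (λ _ → refl))
    (∂²-mixedPart x r r#0) (scaledF-jet root₂)
    (initialValues {b = λ k → U k x} refl at-zero at-one)
    where
    at-zero : mixedPart x r r#0 0 ≈ 1# + 1#
    at-zero = begin
      r⁻¹ * 1# * ((x + r) - 1# * (x - r))
        -- Writing `x` as `r + (x - r)` exhibits `α` as `β + 2r`, so that `β` cancels and the
        -- reciprocal acts on `2r`.
        ≈⟨ *-congˡ (+-congʳ (+-congʳ (y+[x-y]≈x x r))) ⟨
      r⁻¹ * 1# * (((r + (x - r)) + r) - 1# * (x - r))
        ≈⟨ solve 4 (λ t r d e → t :* con 1 :* (((r :+ d) :+ r) :+ e)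
                            := (r :+ r) :* t :+ t :* (d :+ e))
             refl r⁻¹ r (x - r) (- (1# * (x - r))) ⟩
      (r + r) * r⁻¹ + r⁻¹ * ((x - r) - 1# * (x - r))
        ≈⟨ +-congˡ (*-congˡ (trans (+-congˡ (-‿cong (*-identityˡ (x - r)))) (-‿inverseʳ (x - r)))) ⟩
      (r + r) * r⁻¹ + r⁻¹ * 0#
        ≈⟨ solve 2 (λ r t → (r :+ r) :* t :+ t :* con 0 := r :* t :+ r :* t) refl r r⁻¹ ⟩
      r * r⁻¹ + r * r⁻¹
        ≈⟨ +-cong (r*r⁻¹≈1 r r#0) (r*r⁻¹≈1 r r#0) ⟩
      1# + 1# ∎
      where
      r⁻¹ : Carrier
      r⁻¹ = reciprocal r r#0
    -- At odd index the bracket is `α + β = 2x`, and `U 1 x - x * U 0 x` is `x`.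
    at-one : mixedPart x r r#0 1 ≈ (1# + 1#) * (ι 2 * x - x * 1#)
    at-one = begin
      1# * ((x + r) - -1# * 1# * (x - r))
        ≈⟨ *-congˡ (+-congˡ (trans (-‿cong (trans (*-congʳ (*-identityʳ -1#)) (-1*x≈-x (x - r))))
                                   (-‿involutive (x - r)))) ⟩
      1# * ((x + r) + (x - r))
        ≈⟨ solve 3 (λ x r d → con 1 :* ((x :+ r) :+ d) := x :+ (r :+ d)) refl x r (x - r) ⟩
      x + (r + (x - r))
        ≈⟨ +-congˡ (y+[x-y]≈x x r) ⟩
      x + x
        ≈⟨ solve 1 (λ x → x :+ x := (con 1 :+ con 1) :* x) refl x ⟩
      (1# + 1#) * x
        ≈⟨ *-congˡ (y+[x-y]≈x x (x * 1#)) ⟨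
      (1# + 1#) * (x * 1# + (x - x * 1#))
        ≈⟨ *-congˡ (solve 2 (λ x m → x :* con 1 :+ (x :+ m) := (con 1 :+ (con 1 :+ con 0)) :* x :+ m)
                    refl x (- (x * 1#))) ⟩
      (1# + 1#) * (ι 2 * x - x * 1#) ∎

  -- The sums of the two identities as convolutions.

  -- The convolution has one more term, at `k = n`, which vanishes with `oddPart s 0`.
  chebyshevSum≈conv : ∀ n s (b : Sequence) →
    (∑[ i < n ] (let k = toℕ i in
      ι (n C k) * s ^ (n ∸ 1 ∸ k) * (1# - -1# ^ (n ∸ k)) * b k)) ≈ conv (oddPart s) b n
  chebyshevSum≈conv n s b = trans
    (∑<-cong n (λ k → ι (n C k) * s ^ (n ∸ 1 ∸ k) * (1# - -1# ^ (n ∸ k)) * b k)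
      (term (oddPart s) b n) λ k _ → *-congʳ (trans
        (*-assoc _ _ _) (*-congˡ (*-congʳ (reflexive (≡.cong (s ^_) (∸-comm n 1 k)))))))
    (sym (∑<-drop-last n (term (oddPart s) b n) (begin
      ι (n C n) * oddPart s (n ∸ n) * b n
        ≈⟨ *-congʳ (*-congˡ (trans (reflexive (≡.cong (oddPart s) (ℕ.n∸n≡0 n))) (oddPart-zero s))) ⟩
      ι (n C n) * 0# * b n
        ≈⟨ solve 2 (λ u v → u :* con 0 :* v := con 0) refl (ι (n C n)) (b n) ⟩
      0# ∎)))
    where
    ∸-comm : ∀ m i j → m ∸ i ∸ j ≡ m ∸ j ∸ i
    ∸-comm m i j = ≡.trans (ℕ.∸-+-assoc m i j)
      (≡.trans (≡.cong (m ∸_) (ℕ.+-comm i j)) (≡.sym (ℕ.∸-+-assoc m j i)))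

  -- The term of the convolution at index 0 vanishes with `F 0 x`. Power and bracket enter
  -- separately as `p` and `q`, so that both identities fit.
  fibonacciSum≈conv : ∀ n x (c p q : Sequence) →
    (∀ k → suc k ≤ n → p (suc k) * q (suc k) ≈ c (n ∸ suc k)) →
    (∑[ i < n ] (let k = suc (toℕ i) in
      ι (n C k) * ι 2 ^ (k ∸ 1) * p k * q k * F k x)) ≈ conv c (scaledF x) n
  fibonacciSum≈conv n x c p q pq≈c = begin
    ∑< n (λ k → ι (n C suc k) * ι 2 ^ k * p (suc k) * q (suc k) * F (suc k) x)
      ≈⟨ ∑<-cong n _ (∂ (term c (scaledF x) n)) (λ k k<n → trans
           (solve 5 (λ a e u v w → a :* e :* u :* v :* w := a :* (u :* v) :* (e :* w))
             refl (ι (n C suc k)) (ι 2 ^ k) (p (suc k)) (q (suc k)) (F (suc k) x))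
           (*-congʳ (*-congˡ (pq≈c k k<n)))) ⟩
    ∑< n (∂ (term c (scaledF x) n))
      ≈⟨ +-identityˡ _ ⟨
    0# + ∑< n (∂ (term c (scaledF x) n))
      ≈⟨ +-congʳ (trans (*-congˡ (scaledF-zero x)) (zeroʳ _)) ⟨
    conv c (scaledF x) n ∎

-- Specialisation to the complex numbers.

open import Defs
open ChebyshevFibonacci ℂ-heytingField

theorem5 : ∀ (n : ℕ) (x √x²-1 √x²+4 : ℂ)
    (root₁ : √x²-1 * √x²-1 ≈ x * x - 1#) (root₂ : √x²+4 * √x²+4 ≈ x * x + ι 4) →
    ((∑[ i < n ] (let k = toℕ i in
        ι (n C k) * √x²+4 ^ (n ∸ 1 ∸ k) * (1# - (- 1#) ^ (n ∸ k)) * T k x))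
      ≈
     (∑[ i < n ] (let k = suc (toℕ i) in
        ι (n C k) * ι 2 ^ (k ∸ 1) * √x²-1 ^ (n ∸ k) * (1# + (- 1#) ^ (n ∸ k)) * F k x)))
    ×
    ((x²≠1 : x * x # 1#) →
     (∑[ i < n ] (let k = toℕ i in
        ι (n C k) * √x²+4 ^ (n ∸ 1 ∸ k) * (1# - (- 1#) ^ (n ∸ k)) * U k x))
      ≈
     (∑[ i < n ] (let k = suc (toℕ i) in
        ι (n C k) * ι 2 ^ (k ∸ 1) * √x²-1 ^[ sqrt#0 root₁ x²≠1 ] (+ n ℤ.- + 1 ℤ.- + k)
          * (α x √x²-1 - (- 1#) ^ (n ∸ k) * β x √x²-1) * F k x)))
theorem5 n x r s root₁ root₂ =
    trans (chebyshevSum≈conv n s (λ k → T k x))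
      (trans (conv-T {x} {r} {s} root₁ root₂ n)
        (sym (fibonacciSum≈conv n x (evenPart r)
          (λ k → r ^ (n ∸ k)) (λ k → 1# + (- 1#) ^ (n ∸ k)) (λ _ _ → refl))))
  , λ x²≠1 → let r#0 = sqrt#0 {x} {r} root₁ x²≠1 in
    trans (chebyshevSum≈conv n s (λ k → U k x))
      (trans (conv-U {x} {r} {s} root₁ r#0 root₂ n)
        (sym (fibonacciSum≈conv n x (mixedPart x r r#0)
          (λ k → r ^[ r#0 ] (+ n ℤ.- + 1 ℤ.- + k)) (λ k → α x r - (- 1#) ^ (n ∸ k) * β x r)
          (λ k k<n → *-congʳ (reflexive (≡.cong (r ^[ r#0 ]_) (n-1-k≡[n∸k]-1 k<n)))))))
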